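{- For every integer $w \ge 1$ there is a constant $m_0(w)$ with the following property: for all integers $m \ge m_0(w)$ and all positive integers $n$, if $|\mathcal{B}(n,w)| \ge 2^m$, then an $(m,n,w)$-domination mapping exists.
   Context: For $y \in \{0,1\}^n$, $\mathrm{wt}(y)$ is the number of nonzero coordinates of $y$, and $\mathcal{B}(n,w)=\{y\in\{0,1\}^n : \mathrm{wt}(y)\le w\}$. A domination graph is a bipartite graph $G=([m]\cup[n],E)$ with left vertex set $[m]$ and right vertex set $[n]$ (disjoint copies) having no isolated right vertices. Given $G$, an injective map $\varphi:\{0,1\}^m\to\mathcal{B}(n,w)$ is $G$-dominating if for every $x\in\{0,1\}^m$ and every edge $(i,j)\in E$ ($i\in[m]$, $j\in[n]$): if $x_i=0$ then the $j$-th coordinate of $\varphi(x)$ is $0$. An $(m,n,w)$-domination mapping is an injective map $\varphi:\{0,1\}^m\to\mathcal{B}(n,w)$ that is $G$-dominating for some domination graph $G=([m]\cup[n],E)$. -}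

module Defs where

open import Data.Nat using (ℕ; zero; suc; _+_; _≤_; _^_)
open import Data.Bool using (Bool; true; false)
open import Data.Fin using (Fin)
open import Data.Vec using (Vec; []; _∷_; lookup)
open import Data.List using (List; []; _∷_; map; _++_; length; filter)
open import Data.Product using (Σ; ∃; _×_)
open import Relation.Binary.PropositionalEquality using (_≡_)
open import Function.Definitions using (Injective)
open import Data.Nat.Properties using (_≤?_)

wt : ∀ {n} → Vec Bool n → ℕ
wt [] = 0
wt (true ∷ y) = suc (wt y)
wt (false ∷ y) = wt y

allWords : (n : ℕ) → List (Vec Bool n)
allWords zero = [] ∷ []
allWords (suc n) = map (false ∷_) (allWords n) ++ map (true ∷_) (allWords n)

ballSize : ℕ → ℕ → ℕ
ballSize n w = length (filter (λ y → wt y ≤? w) (allWords n))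

-- A bipartite graph on [m] ∪ [n], given by its edge relation E i j (i left, j right)
-- is a domination graph if it has no isolated right vertex.
IsDominationGraph : (m n : ℕ) → (Fin m → Fin n → Bool) → Set
IsDominationGraph m n E = ∀ (j : Fin n) → ∃ λ (i : Fin m) → E i j ≡ true

IsDominating : (m n : ℕ) → (Fin m → Fin n → Bool) → (Vec Bool m → Vec Bool n) → Set
IsDominating m n E φ =
  ∀ (x : Vec Bool m) (i : Fin m) (j : Fin n) → E i j ≡ true →
    lookup x i ≡ false → lookup (φ x) j ≡ false

DominationMapping : (m n w : ℕ) → Set
DominationMapping m n w =
  Σ (Vec Bool m → Vec Bool n) λ φ →
    ((x : Vec Bool m) → wt (φ x) ≤ w) ×
    Injective _≡_ _≡_ φ ×
    Σ (Fin m → Fin n → Bool) λ E →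
      IsDominationGraph m n E × IsDominating m n E φ

{-# OPTIONS --safe #-}
-- Split the right vertices into m consecutive intervals of size at least d = n / m, one for each
-- left vertex.  By Hall's theorem it suffices that every down-set S of {0,1}ᵐ satisfies
-- |S| ≤ |N(S)|, where N(S) consists of the y of weight at most w whose set of hit intervals lies
-- in S.  If S contains every w-set, N(S) is the whole ball, and the hypothesis applies.  Otherwise
-- some w-set is missing, so S is at most 2^w - 1 times as large as its deletion S′ on m - w
-- coordinates; local LYM bounds |S′|, up to polynomially many sets of size < w, by the density of
-- its w-layer times 2^(m-w), while |N(S)| ≥ d^w |S_w|.  Since C(m-w,w) d^w is asymptotically the
-- size of the ball, the factor 1 - 2^-w absorbs all the errors for large m.
module Submission where

open import Defs
open import Data.Nat
open import Data.Nat.Properties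
open import Data.Nat.DivMod using (m≡m%n+[m/n]*n; m%n<n; m*n/n≡m; /-monoˡ-≤)
open import Data.Nat.Tactic.RingSolver using (solve-∀)
open import Data.Bool using (Bool; true; false; _∧_; T)
import Data.Bool as Bool
import Data.Bool.Properties as Bool
open import Data.Fin using (Fin; zero; suc)
import Data.Fin as Fin
open import Data.Vec using (Vec; []; _∷_; lookup; tail; sum; replicate)
import Data.Vec.Properties as Vec
import Data.Vec.Relation.Unary.All as VAll
open VAll using ([]; _∷_)
open import Data.Vec.Relation.Binary.Pointwise.Inductive as Pointwise using (Pointwise; []; _∷_)
open import Data.List using (List; []; _∷_; length; map; filter; _++_)
open import Data.List.Properties using (length-map; filter-notAll; filter-++; length-++)
open import Data.List.Relation.Unary.Any using (Any; here; there; any?)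
import Data.List.Relation.Unary.Any as Any
open import Data.List.Relation.Unary.All using ([]; _∷_)
import Data.List.Relation.Unary.All as All
open import Data.List.Relation.Unary.AllPairs using ([]; _∷_)
open import Data.List.Relation.Unary.Unique.Propositional using (Unique)
open import Data.List.Relation.Unary.Unique.Propositional.Properties using (Unique[x∷xs]⇒x∉xs; filter⁺; ++⁺; map⁺)
open import Data.List.Membership.Propositional using (_∈_; _∉_; lose; find)
open import Data.List.Membership.Propositional.Properties using (∈-filter⁺; ∈-filter⁻; ∈-map⁺; ∈-map⁻; ∈-++⁺ˡ; ∈-++⁺ʳ)
open import Data.Product using (Σ; ∃; _×_; _,_; proj₁; proj₂)
open import Function using (_∘_; case_of_)
open import Relation.Nullary
open import Relation.Nullary.Decidable using (¬?; dec-true; _×-dec_)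
open import Relation.Unary using (Decidable)
open import Relation.Binary using (DecidableEquality)
open import Relation.Binary.PropositionalEquality

-- Down-sets of the cube

infix 4 _⊑_ _⊆_

Family : ℕ → Set
Family n = Vec Bool n → Bool

_⊑_ : ∀ {n} → Vec Bool n → Vec Bool n → Set
_⊑_ = Pointwise Bool._≤_

⊑-refl : ∀ {n} {x : Vec Bool n} → x ⊑ x
⊑-refl = Pointwise.refl Bool.≤-refl

_⊆_ : ∀ {n} → Family n → Family n → Set
S ⊆ R = ∀ x → S x ≡ true → R x ≡ true

DownSet : ∀ {n} → Family n → Set
DownSet S = ∀ {x y} → x ⊑ y → S y ≡ true → S x ≡ true

link : ∀ {n} → Bool → Family (suc n) → Family n
link b S x = S (b ∷ x)

link-down : ∀ {n} b {S : Family (suc n)} → DownSet S → DownSet (link b S)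
link-down b down x⊑y = down (Bool.≤-refl ∷ x⊑y)

link-⊆ : ∀ {n} {S : Family (suc n)} → DownSet S → link true S ⊆ link false S
link-⊆ down x = down (Bool.f≤t ∷ ⊑-refl)

full : ∀ {n} → Family n
full _ = true

indicator : Bool → ℕ
indicator false = 0
indicator true  = 1

card : ∀ {n} → Family n → ℕ
card {zero}  S = indicator (S [])
card {suc n} S = card (link false S) + card (link true S)

layer : ∀ {n} → ℕ → Family n → ℕ
layer {zero}  zero    S = indicator (S [])
layer {zero}  (suc k) S = 0
layer {suc n} zero    S = layer zero (link false S)
layer {suc n} (suc k) S = layer (suc k) (link false S) + layer k (link true S)

below : ∀ {n} → ℕ → Family n → ℕ
below zero    S = 0
below (suc k) S = below k S + layer k S

below-suc : ∀ {n} k (S : Family (suc n)) →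
  below (suc k) S ≡ below (suc k) (link false S) + below k (link true S)
below-suc zero    S = sym (+-identityʳ _)
below-suc (suc k) S rewrite below-suc k S = lemma (below k S₀) (layer k S₀) (below k S₁) (layer (suc k) S₀) (layer k S₁)
  where
  S₀ = link false S
  S₁ = link true S
  lemma : ∀ a b c d e → (a + b + c) + (d + e) ≡ (a + b + d) + (c + e)
  lemma = solve-∀

indicator-mono : ∀ {a b} → (a ≡ true → b ≡ true) → indicator a ≤ indicator b
indicator-mono {false}         _ = z≤n
indicator-mono {true} {true}   _ = ≤-refl
indicator-mono {true} {false}  f = case f refl of λ ()

card-mono : ∀ {n} {S R : Family n} → S ⊆ R → card S ≤ card R
card-mono {zero}  S⊆R = indicator-mono (S⊆R [])
card-mono {suc n} S⊆R = +-mono-≤ (card-mono (S⊆R ∘ (false ∷_))) (card-mono (S⊆R ∘ (true ∷_)))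

card-cong : ∀ {n} {S R : Family n} → (∀ x → S x ≡ R x) → card S ≡ card R
card-cong {zero}  S≗R = cong indicator (S≗R [])
card-cong {suc n} S≗R = cong₂ _+_ (card-cong (S≗R ∘ (false ∷_))) (card-cong (S≗R ∘ (true ∷_)))

card-full : ∀ n → card (full {n}) ≡ 2 ^ n
card-full zero    = refl
card-full (suc n) rewrite card-full n = cong (2 ^ n +_) (sym (+-identityʳ _))

layer-mono : ∀ {n} k {S R : Family n} → S ⊆ R → layer k S ≤ layer k R
layer-mono {zero}  zero    S⊆R = indicator-mono (S⊆R [])
layer-mono {zero}  (suc k) S⊆R = z≤n
layer-mono {suc n} zero    S⊆R = layer-mono zero (S⊆R ∘ (false ∷_))
layer-mono {suc n} (suc k) S⊆R =
  +-mono-≤ (layer-mono (suc k) (S⊆R ∘ (false ∷_))) (layer-mono k (S⊆R ∘ (true ∷_)))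

below-mono : ∀ {n} k {S R : Family n} → S ⊆ R → below k S ≤ below k R
below-mono zero    S⊆R = z≤n
below-mono (suc k) S⊆R = +-mono-≤ (below-mono k S⊆R) (layer-mono k S⊆R)

below-monoˡ : ∀ {n} {j k} (S : Family n) → j ≤ k → below j S ≤ below k S
below-monoˡ S j≤k with ≤⇒≤′ j≤k
... | ≤′-refl       = ≤-refl
... | ≤′-step j≤′k = ≤-trans (below-monoˡ S (≤′⇒≤ j≤′k)) (m≤m+n _ _)

below≤card : ∀ {n} k (S : Family n) → below k S ≤ card S
below≤card         zero          S = z≤n
below≤card {zero}  (suc zero)    S = ≤-refl
below≤card {zero}  (suc (suc k)) S =
  ≤-trans (≤-reflexive (+-identityʳ _)) (below≤card (suc k) S)
below≤card {suc n} (suc k)       S = ≤-trans (≤-reflexive (below-suc k S))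
  (+-mono-≤ (below≤card (suc k) (link false S)) (below≤card k (link true S)))

card≤below : ∀ {n} k (S : Family n) → n < k → card S ≤ below k S
card≤below {zero}  (suc zero)    S _         = ≤-refl
card≤below {zero}  (suc (suc k)) S _         =
  ≤-trans (card≤below (suc k) S z<s) (m≤m+n _ _)
card≤below {suc n} (suc k)       S (s≤s n<k) = ≤-trans
  (+-mono-≤ (card≤below (suc k) (link false S) (m<n⇒m<1+n n<k)) (card≤below k (link true S) n<k))
  (≤-reflexive (sym (below-suc k S)))

-- The local LYM inequality and layer densities

-- Double counting of pairs y ⊂ z on adjacent layers: each z has `suc k` such y, all in `S` by
-- downward closure, and each y has n - k supersets. Moving k to the left avoids truncated
-- subtraction.
local-LYM : ∀ {n} k {S : Family n} → DownSet S →
  suc k * layer (suc k) S + k * layer k S ≤ n * layer k S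
local-LYM {zero}  zero    down = z≤n
local-LYM {zero}  (suc k) down = ≤-reflexive (lemma k)
  where
  lemma : ∀ k → suc (suc k) * 0 + suc k * 0 ≡ 0
  lemma = solve-∀
local-LYM {suc n} zero {S} down = begin
  1 * (a + b) + 0   ≡⟨ lemma a b ⟩
  b + (1 * a + 0)   ≤⟨ +-mono-≤ (layer-mono 0 (link-⊆ down)) (local-LYM zero (link-down false down)) ⟩
  suc n * layer 0 (link false S) ∎
  where
  open ≤-Reasoning
  a = layer 1 (link false S)
  b = layer 0 (link true S)
  lemma : ∀ a b → 1 * (a + b) + 0 ≡ b + (1 * a + 0)
  lemma = solve-∀
local-LYM {suc n} (suc k) {S} down = begin
  suc (suc k) * (a + b) + suc k * (c + d)
    ≡⟨ lemma k a b c d ⟩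
  (suc (suc k) * a + suc k * c) + (suc k * b + k * d) + b + d
    -- The leftover `b` counts sets containing the first element; removing it bounds `b` by `c`.
    ≤⟨ +-monoˡ-≤ d (+-mono-≤ (+-mono-≤ (local-LYM (suc k) (link-down false down))
                                         (local-LYM k (link-down true down)))
                             (layer-mono (suc k) (link-⊆ down))) ⟩
  n * c + n * d + c + d
    ≡⟨ lemma′ n c d ⟩
  suc n * (c + d) ∎
  where
  open ≤-Reasoning
  a = layer (suc (suc k)) (link false S)
  b = layer (suc k) (link true S)
  c = layer (suc k) (link false S)
  d = layer k (link true S)
  lemma : ∀ k a b c d → suc (suc k) * (a + b) + suc k * (c + d) ≡
    (suc (suc k) * a + suc k * c) + (suc k * b + k * d) + b + d
  lemma = solve-∀
  lemma′ : ∀ n c d → n * c + n * d + c + d ≡ suc n * (c + d)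
  lemma′ = solve-∀

-- Binomial coefficients as layers of the full cube: Pascal's rule holds by computation, and `S`
-- compares with `full` layer by layer.
binom : ℕ → ℕ → ℕ
binom n k = layer k (full {n})

-- The equality case of `local-LYM`, by the same induction with both links full.
binom-absorb : ∀ n k → suc k * binom n (suc k) + k * binom n k ≡ n * binom n k
binom-absorb zero    zero    = refl
binom-absorb zero    (suc k) = lemma k
  where
  lemma : ∀ k → suc (suc k) * 0 + suc k * 0 ≡ 0
  lemma = solve-∀
binom-absorb (suc n) zero    = trans (lemma (binom n 1) (binom n 0)) (cong (binom n 0 +_) (binom-absorb n 0))
  where
  lemma : ∀ a b → 1 * (a + b) + 0 ≡ b + (1 * a + 0)
  lemma = solve-∀
binom-absorb (suc n) (suc k) = begin
  suc (suc k) * (a + c) + suc k * (c + d)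
    ≡⟨ lemma k a c d ⟩
  (suc (suc k) * a + suc k * c) + (suc k * c + k * d) + c + d
    ≡⟨ cong₂ (λ u v → u + v + c + d) (binom-absorb n (suc k)) (binom-absorb n k) ⟩
  n * c + n * d + c + d
    ≡⟨ lemma′ n c d ⟩
  suc n * (c + d) ∎
  where
  open ≡-Reasoning
  a = binom n (suc (suc k))
  c = binom n (suc k)
  d = binom n k
  lemma : ∀ k a c d → suc (suc k) * (a + c) + suc k * (c + d) ≡
    (suc (suc k) * a + suc k * c) + (suc k * c + k * d) + c + d
  lemma = solve-∀
  lemma′ : ∀ n c d → n * c + n * d + c + d ≡ suc n * (c + d)
  lemma′ = solve-∀

layer-suc-≤ : ∀ {n} k {S : Family n} → DownSet S →
  suc k * layer (suc k) S ≤ (n ∸ k) * layer k S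
layer-suc-≤ {n} k {S} down = ≤-trans (m+n≤o⇒m≤o∸n _ (local-LYM k down))
  (≤-reflexive (sym (*-distribʳ-∸ (layer k S) n k)))

binom-suc : ∀ n k → suc k * binom n (suc k) ≡ (n ∸ k) * binom n k
binom-suc n k = begin
  suc k * binom n (suc k)                                 ≡⟨ m+n∸n≡m _ (k * binom n k) ⟨
  suc k * binom n (suc k) + k * binom n k ∸ k * binom n k ≡⟨ cong (_∸ k * binom n k) (binom-absorb n k) ⟩
  n * binom n k ∸ k * binom n k                           ≡⟨ *-distribʳ-∸ (binom n k) n k ⟨
  (n ∸ k) * binom n k                                     ∎
  where open ≡-Reasoning

-- From layer k to k + 1 the binomial coefficient gains exactly the factor (n - k)/(k + 1) and the
-- layer of `S` at most that, so the density cannot rise. Cross-multiplied to avoid division.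
layer-density : ∀ {n} w j {S : Family n} → DownSet S →
  layer (j + w) S * binom n w ≤ layer w S * binom n (j + w)
layer-density     w zero        down = ≤-refl
layer-density {n} w (suc j) {S} down = *-cancelˡ-≤ (suc k) (begin
  suc k * (layer (suc k) S * binom n w)   ≡⟨ *-assoc (suc k) (layer (suc k) S) (binom n w) ⟨
  suc k * layer (suc k) S * binom n w     ≤⟨ *-monoˡ-≤ _ (layer-suc-≤ k down) ⟩
  (n ∸ k) * layer k S * binom n w         ≡⟨ *-assoc (n ∸ k) (layer k S) (binom n w) ⟩
  (n ∸ k) * (layer k S * binom n w)       ≤⟨ *-monoʳ-≤ (n ∸ k) (layer-density w j down) ⟩
  (n ∸ k) * (layer w S * binom n k)       ≡⟨ *-left-comm (n ∸ k) (layer w S) (binom n k) ⟩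
  layer w S * ((n ∸ k) * binom n k)       ≡⟨ cong (layer w S *_) (binom-suc n k) ⟨
  layer w S * (suc k * binom n (suc k))   ≡⟨ *-left-comm (layer w S) (suc k) (binom n (suc k)) ⟩
  suc k * (layer w S * binom n (suc k))   ∎)
  where
  open ≤-Reasoning
  k = j + w
  *-left-comm : ∀ a b c → a * (b * c) ≡ b * (a * c)
  *-left-comm = solve-∀

below-density : ∀ {n} w j {S : Family n} → DownSet S →
  below (j + w) S * binom n w ≤ below w S * binom n w + layer w S * below (j + w) (full {n})
below-density         w zero        down = m≤m+n _ _
below-density {n} w (suc j) {S} down = begin
  (below k S + layer k S) * b                             ≡⟨ *-distribʳ-+ b (below k S) _ ⟩
  below k S * b + layer k S * b                           ≤⟨ +-mono-≤ (below-density w j down) (layer-density w j down) ⟩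
  below w S * b + t * below k (full {n}) + t * binom n k  ≡⟨ +-assoc (below w S * b) _ _ ⟩
  below w S * b + (t * below k (full {n}) + t * binom n k) ≡⟨ cong (below w S * b +_) (*-distribˡ-+ t _ _) ⟨
  below w S * b + t * below (suc k) (full {n})            ∎
  where
  open ≤-Reasoning
  k = j + w
  b = binom n w
  t = layer w S

-- Layers from `w` up are at most as dense as layer `w`, and their binomial coefficients sum to at
-- most 2^n. The layers under `w` are counted as they are.
card-density : ∀ {n} w {S : Family n} → DownSet S →
  card S * binom n w ≤ below w S * binom n w + layer w S * 2 ^ n
card-density {n} w {S} down = begin
  -- `suc n + w` exceeds `n`, so no member is lost, and has the shape required by `below-density`.
  card S * binom n w                ≤⟨ *-monoˡ-≤ _ (card≤below (suc n + w) S (m≤m+n (suc n) w)) ⟩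
  below (suc n + w) S * binom n w   ≤⟨ below-density w (suc n) down ⟩
  below w S * binom n w + layer w S * below (suc n + w) (full {n})
    ≤⟨ +-monoʳ-≤ _ (*-monoʳ-≤ (layer w S) (below≤card (suc n + w) (full {n}))) ⟩
  below w S * binom n w + layer w S * card (full {n})
    ≡⟨ cong (λ c → below w S * binom n w + layer w S * c) (card-full n) ⟩
  below w S * binom n w + layer w S * 2 ^ n ∎
  where open ≤-Reasoning

-- Deleting the elements of a set

avoids : ∀ {n} → Vec Bool n → ℕ
avoids []          = 0
avoids (true ∷ x)  = avoids x
avoids (false ∷ x) = suc (avoids x)

avoids+wt : ∀ {n} (x : Vec Bool n) → avoids x + wt x ≡ n
avoids+wt []          = refl
avoids+wt (true ∷ x)  = trans (+-suc _ _) (cong suc (avoids+wt x))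
avoids+wt (false ∷ x) = cong suc (avoids+wt x)

-- The members of S disjoint from x, as subsets of the complement of x.
deletion : ∀ {n} (x : Vec Bool n) → Family n → Family (avoids x)
deletion []          S = S
deletion (true ∷ x)  S = deletion x (link false S)
deletion (false ∷ x) S (b ∷ z) = deletion x (link b S) z

deletion-down : ∀ {n} (x : Vec Bool n) {S : Family n} → DownSet S → DownSet (deletion x S)
deletion-mono : ∀ {n} (x : Vec Bool n) {S R : Family n} → S ⊆ R → deletion x S ⊆ deletion x R
deletion-mono []          S⊆R         = S⊆R
deletion-mono (true ∷ x)  S⊆R         = deletion-mono x (S⊆R ∘ (false ∷_))
deletion-mono (false ∷ x) S⊆R (b ∷ z) = deletion-mono x (S⊆R ∘ (b ∷_)) z

deletion-down []          down = down
deletion-down (true ∷ x)  down = deletion-down x (link-down false down)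
deletion-down (false ∷ x) down {false ∷ _} (Bool.b≤b ∷ y⊑z) = deletion-down x (link-down false down) y⊑z
deletion-down (false ∷ x) down {true ∷ _} (Bool.b≤b ∷ y⊑z) = deletion-down x (link-down true down) y⊑z
deletion-down (false ∷ x) {S} down (Bool.f≤t ∷ y⊑z) =
  deletion-mono x (link-⊆ down) _ ∘ deletion-down x (link-down true down) y⊑z

layer-deletion : ∀ {n} k (x : Vec Bool n) (S : Family n) → layer k (deletion x S) ≤ layer k S
layer-deletion k       []          S = ≤-refl
layer-deletion zero    (true ∷ x)  S = layer-deletion zero x (link false S)
layer-deletion (suc k) (true ∷ x)  S = ≤-trans (layer-deletion (suc k) x (link false S)) (m≤m+n _ _)
layer-deletion zero    (false ∷ x) S = layer-deletion zero x (link false S)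
layer-deletion (suc k) (false ∷ x) S =
  +-mono-≤ (layer-deletion (suc k) x (link false S)) (layer-deletion k x (link true S))

-- Group the members of `S` by their trace on `x`. Removing the trace stays inside `S`, so each of
-- the `2 ^ wt x` groups embeds in the deletion.
card-deletion : ∀ {n} (x : Vec Bool n) {S : Family n} → DownSet S →
  card S ≤ 2 ^ wt x * card (deletion x S)
card-deletion []          down = ≤-reflexive (sym (+-identityʳ _))
card-deletion (false ∷ x) {S} down = ≤-trans
  (+-mono-≤ (card-deletion x (link-down false down)) (card-deletion x (link-down true down)))
  (≤-reflexive (sym (*-distribˡ-+ (2 ^ wt x) _ _)))
card-deletion (true ∷ x) {S} down = begin
  card (link false S) + card (link true S) ≤⟨ +-monoʳ-≤ _ (card-mono (link-⊆ down)) ⟩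
  card (link false S) + card (link false S) ≤⟨ +-mono-≤ ih ih ⟩
  p * D + p * D                             ≡⟨ lemma p D ⟩
  2 * p * D                                 ∎
  where
  open ≤-Reasoning
  p = 2 ^ wt x
  D = card (deletion x (link false S))
  ih = card-deletion x (link-down false down)
  lemma : ∀ p d → p * d + p * d ≡ 2 * p * d
  lemma = solve-∀

-- The number 2^k - 1 of proper subsets of a k-set. The recursion is that of
-- `card-deletion-missing`: of a (k+1)-set, 2^k proper subsets omit the first element, and the
-- others are proper on the rest.
mersenne : ℕ → ℕ
mersenne zero    = 0
mersenne (suc k) = 2 ^ k + mersenne k

suc-mersenne : ∀ k → suc (mersenne k) ≡ 2 ^ k
suc-mersenne zero    = refl
suc-mersenne (suc k) = trans (sym (+-suc (2 ^ k) (mersenne k)))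
  (cong (2 ^ k +_) (trans (suc-mersenne k) (sym (+-identityʳ _))))

-- The links of S at the proper subsets of x all embed in the deletion of x.
card-deletion-missing : ∀ {n} (x : Vec Bool n) {S : Family n} → DownSet S → S x ≡ false →
  card S ≤ mersenne (wt x) * card (deletion x S)
card-deletion-missing [] {S} down Sx rewrite Sx = z≤n
card-deletion-missing (false ∷ x) {S} down Sx = ≤-trans
  (+-mono-≤ (card-deletion-missing x (link-down false down) Sx)
             (card-deletion-missing x (link-down true down) S₁x))
  (≤-reflexive (sym (*-distribˡ-+ (mersenne (wt x)) _ _)))
  where
  S₁x : S (true ∷ x) ≡ false
  S₁x = Bool.¬-not λ S₁x → case trans (sym Sx) (link-⊆ down x S₁x) of λ ()
card-deletion-missing (true ∷ x) {S} down Sx = begin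
  card (link false S) + card (link true S)
    ≤⟨ +-mono-≤ (card-deletion x (link-down false down)) (card-deletion-missing x (link-down true down) Sx) ⟩
  2 ^ wt x * D + mersenne (wt x) * card (deletion x (link true S))
    ≤⟨ +-monoʳ-≤ (2 ^ wt x * D) (*-monoʳ-≤ (mersenne (wt x)) (card-mono (deletion-mono x (link-⊆ down)))) ⟩
  2 ^ wt x * D + mersenne (wt x) * D
    ≡⟨ *-distribʳ-+ D (2 ^ wt x) _ ⟨
  (2 ^ wt x + mersenne (wt x)) * D ∎
  where
  open ≤-Reasoning
  D = card (deletion x (link false S))

-- Hall's theorem

-- Pigeonhole. If the head of `xs` occurs in `ys`, erasing its copies shortens `ys`, and uniqueness
-- keeps the witness found in the tail different from the head.
fresh-element : ∀ {A : Set} → DecidableEquality A → ∀ {xs ys : List A} →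
  Unique xs → length ys < length xs → ∃ λ x → x ∈ xs × x ∉ ys
fresh-element _≟_ {x ∷ xs} {ys} u@(_ ∷ u′) (s≤s ys≤xs) with any? (x ≟_) ys
... | no  x∉ys = x , here refl , x∉ys
... | yes x∈ys with fresh-element _≟_ {xs} {filter (λ y → ¬? (x ≟ y)) ys} u′
                      (≤-trans (filter-notAll (λ y → ¬? (x ≟ y)) ys (Any.map (λ x≡y x≢y → x≢y x≡y) x∈ys)) ys≤xs)
...   | z , z∈xs , z∉ = z , there z∈xs , λ z∈ys →
  z∉ (∈-filter⁺ (λ y → ¬? (x ≟ y)) z∈ys λ { refl → Unique[x∷xs]⇒x∉xs u z∈xs })

module _ {X Y : Set} (_≟X_ : DecidableEquality X) (_≟Y_ : DecidableEquality Y)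
         (_∼_ : X → Y → Set) where

  HallCondition : Set
  HallCondition = ∀ (R : List X) → Unique R →
    Σ (List Y) λ N → Unique N × (∀ {y} → y ∈ N → ∃ λ x → x ∈ R × x ∼ y) × length R ≤ length N

  -- `D` cuts a total map down to the matched vertices, so that unmatching a vertex only shrinks
  -- `D`.
  record IsMatching (D : X → Set) (M : X → Y) : Set where
    field
      valid     : ∀ {a} → D a → a ∼ M a
      injective : ∀ {a b} → D a → D b → M a ≡ M b → a ≡ b

  open IsMatching

  update : (X → Y) → X → Y → X → Y
  update M a y b with b ≟X a
  ... | yes _ = y
  ... | no  _ = M b

  update-≢ : ∀ M a y {b} → b ≢ a → update M a y b ≡ M b
  update-≢ M a y {b} b≢a with b ≟X a
  ... | yes b≡a = contradiction b≡a b≢a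
  ... | no  _   = refl

  update-matching : ∀ {D M a y} → IsMatching (λ b → D b × b ≢ a) M → a ∼ y →
    (∀ {b} → D b → b ≢ a → M b ≢ y) → IsMatching D (update M a y)
  update-matching {D} {M} {a} {y} m a∼y new = record { valid = valid′ ; injective = injective′ }
    where
    valid′ : ∀ {b} → D b → b ∼ update M a y b
    valid′ {b} Db with b ≟X a
    ... | yes refl = a∼y
    ... | no  b≢a  = valid m (Db , b≢a)
    injective′ : ∀ {b c} → D b → D c → update M a y b ≡ update M a y c → b ≡ c
    injective′ {b} {c} Db Dc eq with b ≟X a | c ≟X a
    ... | yes refl | yes refl = refl
    ... | yes refl | no  c≢a  = contradiction (sym eq) (new Dc c≢a)
    ... | no  b≢a  | yes refl = contradiction eq (new Db b≢a)
    ... | no  b≢a  | no  c≢a  = injective m (Db , b≢a) (Dc , c≢a) eq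

  module _ (hall : HallCondition) (x : X) (L : List X) (x∉L : x ∉ L)
           (M : X → Y) (m : IsMatching (_∈ L) M) where

    -- a can be reached from x by an M-alternating path inside x ∷ R: shifting the matching along
    -- that path leaves a as the only unmatched vertex of x ∷ L.
    record Reachable (R : List X) (a : X) : Set where
      field
        shifted   : X → Y
        matching  : IsMatching (λ b → b ∈ x ∷ L × b ≢ a) shifted
        image     : ∀ {b} → b ∈ x ∷ L → b ≢ a → ∃ λ c → c ∈ L × M c ≡ shifted b
        unchanged : ∀ {b} → b ∉ x ∷ R → shifted b ≡ M b

    open Reachable

    ∷-there : ∀ {R b z} → b ∈ x ∷ R → b ∈ x ∷ z ∷ R
    ∷-there (here eq)  = here eq
    ∷-there (there b∈) = there (there b∈)

    weaken : ∀ {R a z} → Reachable R a → Reachable (z ∷ R) a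
    weaken r = record
      { shifted = shifted r ; matching = matching r ; image = image r
      ; unchanged = λ b∉ → unchanged r (b∉ ∘ ∷-there) }

    -- Giving `M z` to `a` frees `z`. No other vertex holds `M z`: as `z` lies outside `x ∷ R`, its
    -- own shifted value is still `M z`, and the shifted matching is injective.
    extend : ∀ {R a z} → Reachable R a → a ∈ x ∷ R → z ∈ L → z ∉ x ∷ R → a ∼ M z → Reachable (z ∷ R) z
    extend {R} {a} {z} r a∈R z∈L z∉R a∼Mz = record
      { shifted = update (shifted r) a (M z)
      ; matching = update-matching
          (record { valid = λ ((b∈ , _) , b≢a) → valid (matching r) (b∈ , b≢a)
                  ; injective = λ ((b∈ , _) , b≢a) ((c∈ , _) , c≢a) → injective (matching r) (b∈ , b≢a) (c∈ , c≢a) })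
          a∼Mz
          (λ (b∈ , b≢z) b≢a eq → b≢z (injective (matching r) (b∈ , b≢a) (there z∈L , z≢a)
                                        (trans eq (sym (unchanged r z∉R)))))
      ; image = image′
      ; unchanged = λ b∉ → trans (update-≢ _ a _ (λ { refl → b∉ (∷-there a∈R) })) (unchanged r (b∉ ∘ ∷-there))
      }
      where
      z≢a : z ≢ a
      z≢a refl = z∉R a∈R
      image′ : ∀ {b} → b ∈ x ∷ L → b ≢ z → ∃ λ c → c ∈ L × M c ≡ update (shifted r) a (M z) b
      image′ {b} b∈ b≢z with b ≟X a
      ... | yes _   = z , z∈L , refl
      ... | no  b≢a = image r b∈ b≢a

    -- Grows the set `R` of reached vertices. Hall's condition for `x ∷ R` gives a neighbour outside
    -- the image of `R`: if it is free, the matching is augmented; if it is `M z`, then `z` joins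
    -- `R`. Fuel bounds the growth by `length L`.
    search : ∀ fuel R → Unique (x ∷ R) → (∀ {a} → a ∈ R → a ∈ L) →
      (∀ {a} → a ∈ x ∷ R → Reachable R a) →
      length L ≤ fuel + length R → ∃ λ M′ → IsMatching (_∈ x ∷ L) M′
    search fuel R u R⊆L reach bound with hall (x ∷ R) u
    ... | N , uN , adjacent , xR≤N
      with fresh-element _≟Y_ {N} {map M R} uN (subst (_< length N) (sym (length-map M R)) xR≤N)
    ... | y , y∈N , y∉MR with adjacent y∈N
    ... | a , a∈xR , a∼y with any? (λ z → M z ≟Y y) L
    -- The shifted matching takes only values of `M` on `L`, so `y` is free there too.
    ... | no y∉ML = _ , update-matching (matching (reach a∈xR)) a∼y λ b∈ b≢a eq →
      let c , c∈L , Mc≡ = image (reach a∈xR) b∈ b≢a in y∉ML (lose c∈L (trans Mc≡ eq))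
    ... | yes y∈ML with find y∈ML
    ... | z , z∈L , refl = continue fuel bound
      where
      z∉xR : z ∉ x ∷ R
      z∉xR (here refl) = x∉L z∈L
      z∉xR (there z∈R) = y∉MR (∈-map⁺ M z∈R)
      reach′ : ∀ {b} → b ∈ x ∷ z ∷ R → Reachable (z ∷ R) b
      reach′ (here refl)         = weaken (reach (here refl))
      reach′ (there (here refl)) = extend (reach a∈xR) a∈xR z∈L z∉xR a∼y
      reach′ (there (there b∈))  = weaken (reach (there b∈))
      unique : Unique (z ∷ R)
      unique = All.tabulate (λ { b∈R refl → z∉xR (there b∈R) }) ∷ (case u of λ { (_ ∷ u′) → u′ })
      zR⊆L : ∀ {b} → b ∈ z ∷ R → b ∈ L
      zR⊆L (here refl) = z∈L
      zR⊆L (there b∈R) = R⊆L b∈R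
      continue : ∀ fuel → length L ≤ fuel + length R → ∃ λ M′ → IsMatching (_∈ x ∷ L) M′
      -- `R` is already as long as `L`, so the duplicate-free `z ∷ R` cannot fit into `L`.
      continue zero L≤R =
        let b , b∈ , b∉L = fresh-element _≟X_ unique (s≤s L≤R) in contradiction (zR⊆L b∈) b∉L
      continue (suc fuel) bound′ = search fuel (z ∷ R)
        (All.tabulate (λ { b∈ refl → x∉L (zR⊆L b∈) }) ∷ unique)
        zR⊆L reach′
        (≤-trans bound′ (≤-reflexive (sym (+-suc fuel (length R)))))

    augment : ∃ λ M′ → IsMatching (_∈ x ∷ L) M′
    augment = search (length L) [] ([] ∷ []) (λ ()) start (≤-reflexive (sym (+-identityʳ _)))
      where
      ∈L : ∀ {b} → b ∈ x ∷ L → b ≢ x → b ∈ L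
      ∈L (here b≡x)  b≢x = contradiction b≡x b≢x
      ∈L (there b∈L) b≢x = b∈L
      start : ∀ {a} → a ∈ x ∷ [] → Reachable [] a
      start (here refl) = record
        { shifted   = M
        ; matching  = record { valid = λ (b∈ , b≢x) → valid m (∈L b∈ b≢x)
                             ; injective = λ (b∈ , b≢x) (c∈ , c≢x) → injective m (∈L b∈ b≢x) (∈L c∈ c≢x) }
        ; image     = λ b∈ b≢x → _ , ∈L b∈ b≢x , refl
        ; unchanged = λ _ → refl }

  hall-theorem : HallCondition → Y → (L : List X) → Unique L → ∃ λ M → IsMatching (_∈ L) M
  hall-theorem hall y₀ []      _ = (λ _ → y₀) , record { valid = λ () ; injective = λ () }
  hall-theorem hall y₀ (x ∷ L) u@(_ ∷ u′) =
    let M , m = hall-theorem hall y₀ L u′ in augment hall x L (Unique[x∷xs]⇒x∉xs u) M m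

-- Domination from expansion of down-sets

length-filter-map : ∀ {A B : Set} {P : B → Set} (P? : Decidable P) (f : A → B) xs →
  length (filter P? (map f xs)) ≡ length (filter (P? ∘ f) xs)
length-filter-map P? f []       = refl
length-filter-map P? f (x ∷ xs) with does (P? (f x))
... | true  = cong suc (length-filter-map P? f xs)
... | false = length-filter-map P? f xs

length-filter-allWords : ∀ n {P : Vec Bool n → Set} (P? : Decidable P) →
  length (filter P? (allWords n)) ≡ card (λ x → does (P? x))
length-filter-allWords zero    P? with does (P? [])
... | true  = refl
... | false = refl
length-filter-allWords (suc n) P? = begin
  length (filter P? (map (false ∷_) (allWords n) ++ map (true ∷_) (allWords n)))
    ≡⟨ cong length (filter-++ P? (map (false ∷_) (allWords n)) _) ⟩
  length (filter P? (map (false ∷_) (allWords n)) ++ filter P? (map (true ∷_) (allWords n)))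
    ≡⟨ length-++ (filter P? (map (false ∷_) (allWords n))) ⟩
  length (filter P? (map (false ∷_) (allWords n))) + length (filter P? (map (true ∷_) (allWords n)))
    ≡⟨ cong₂ _+_ (length-filter-map P? _ (allWords n)) (length-filter-map P? _ (allWords n)) ⟩
  length (filter (P? ∘ (false ∷_)) (allWords n)) + length (filter (P? ∘ (true ∷_)) (allWords n))
    ≡⟨ cong₂ _+_ (length-filter-allWords n _) (length-filter-allWords n _) ⟩
  card (λ x → does (P? x)) ∎
  where open ≡-Reasoning

∈-allWords : ∀ {n} (x : Vec Bool n) → x ∈ allWords n
∈-allWords []          = Any.here refl
∈-allWords (false ∷ x) = ∈-++⁺ˡ (∈-map⁺ _ (∈-allWords x))
∈-allWords (true ∷ x)  = ∈-++⁺ʳ _ (∈-map⁺ _ (∈-allWords x))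

allWords-unique : ∀ n → Unique (allWords n)
allWords-unique zero    = [] ∷ []
allWords-unique (suc n) =
  ++⁺ (map⁺ Vec.∷-injectiveʳ (allWords-unique n)) (map⁺ Vec.∷-injectiveʳ (allWords-unique n)) disjoint
  where
  disjoint : ∀ {x} → ¬ (x ∈ map (false ∷_) (allWords n) × x ∈ map (true ∷_) (allWords n))
  disjoint (x∈₀ , x∈₁) with ∈-map⁻ _ x∈₀ | ∈-map⁻ _ x∈₁
  ... | _ , _ , refl | _ , _ , ()

_≟W_ : ∀ {n} (x y : Vec Bool n) → Dec (x ≡ y)
_≟W_ = Vec.≡-dec Bool._≟_

unique-length-≤-card : ∀ {n} {S : Family n} {R : List (Vec Bool n)} → Unique R →
  (∀ {x} → x ∈ R → S x ≡ true) → length R ≤ card S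
unique-length-≤-card {n} {S} {R} u R⊆S = begin
  length R                         ≤⟨ ≮⇒≥ too-long ⟩
  length (filter S? (allWords n))  ≡⟨ length-filter-allWords n S? ⟩
  card (λ x → does (S? x))         ≤⟨ card-mono (λ x → does-true (S? x)) ⟩
  card S                           ∎
  where
  open ≤-Reasoning
  S? : Decidable (λ x → S x ≡ true)
  S? x = S x Bool.≟ true
  too-long : ¬ length (filter S? (allWords n)) < length R
  too-long lt = let x , x∈R , x∉ = fresh-element _≟W_ u lt
                in x∉ (∈-filter⁺ S? (∈-allWords x) (R⊆S x∈R))
  does-true : ∀ {P : Set} (P? : Dec P) → does P? ≡ true → P
  does-true (yes p) _ = p

-- With `<ᵇ` and a successor, prefixing `true` computes to the ball of radius one less, or to the
-- empty family at radius 0.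
ball : ∀ {n} → ℕ → Family n
ball s y = wt y <ᵇ suc s

card-empty : ∀ n → card {n} (λ _ → false) ≡ 0
card-empty zero    = refl
card-empty (suc n) rewrite card-empty n = refl

card-ball : ∀ n s → card (ball {n} s) ≡ below (suc s) (full {n})
card-ball zero    zero    = refl
card-ball zero    (suc s) = trans (card-ball zero s) (sym (+-identityʳ _))
card-ball (suc n) zero    = trans (cong₂ _+_ (card-ball n zero) (card-empty n)) (+-identityʳ _)
card-ball (suc n) (suc s) = trans (cong₂ _+_ (card-ball n (suc s)) (card-ball n s)) (sym (below-suc (suc s) full))

ball-intro : ∀ {n s} {y : Vec Bool n} → wt y ≤ s → ball s y ≡ true
ball-intro {s = s} {y} le with wt y <ᵇ suc s | <⇒<ᵇ (s≤s le)
... | true | _ = refl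

ball-elim : ∀ {n} s (y : Vec Bool n) → ball s y ≡ true → wt y ≤ s
ball-elim s y eq = s≤s⁻¹ (<ᵇ⇒< (wt y) (suc s) (subst T (sym eq) _))

ballSize-below : ∀ n w → ballSize n w ≤ below (suc w) (full {n})
ballSize-below n w = begin
  ballSize n w                   ≡⟨ length-filter-allWords n (λ y → wt y ≤? w) ⟩
  card (λ y → does (wt {n} y ≤? w)) ≤⟨ card-mono {n} (λ y eq → ball-intro {y = y} (≤ᵇ⇒≤ (wt y) w (subst T (sym eq) _))) ⟩
  card (ball {n} w)              ≡⟨ card-ball n w ⟩
  below (suc w) full             ∎
  where open ≤-Reasoning

-- Shadows and neighbourhoods for an interval partition

-- A domination graph in which every right vertex has one neighbour amounts to a partition of the
-- right vertices into m parts, here consecutive intervals of sizes d₁, …, dₘ.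
part : ∀ {m} (ds : Vec ℕ m) → Fin (sum ds) → Fin m
part (zero ∷ ds)  j       = suc (part ds j)
part (suc d ∷ ds) zero    = zero
part (suc d ∷ ds) (suc j) = part (d ∷ ds) j

-- The set of parts hit by the word. A `true` overrides the bit computed from the remainder of its
-- part.
shadow : ∀ {m} (ds : Vec ℕ m) → Vec Bool (sum ds) → Vec Bool m
shadow []           []          = []
shadow (zero ∷ ds)  y           = false ∷ shadow ds y
shadow (suc d ∷ ds) (false ∷ y) = shadow (d ∷ ds) y
shadow (suc d ∷ ds) (true ∷ y)  = true ∷ tail (shadow (d ∷ ds) y)

shadow-part : ∀ {m} (ds : Vec ℕ m) (y : Vec Bool (sum ds)) j →
  lookup y j ≡ true → lookup (shadow ds y) (part ds j) ≡ true
shadow-part (zero ∷ ds)  y           j       yj = shadow-part ds y j yj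
shadow-part (suc d ∷ ds) (true ∷ y)  zero    yj = refl
shadow-part (suc d ∷ ds) (false ∷ y) (suc j) yj = shadow-part (d ∷ ds) y j yj
shadow-part (suc d ∷ ds) (true ∷ y)  (suc j) yj =
  set-head (shadow (d ∷ ds) y) (part (d ∷ ds) j) (shadow-part (d ∷ ds) y j yj)
  where
  set-head : ∀ {n} (v : Vec Bool (suc n)) i → lookup v i ≡ true → lookup (true ∷ tail v) i ≡ true
  set-head (_ ∷ v) zero    _  = refl
  set-head (_ ∷ v) (suc i) eq = eq

wt-shadow : ∀ {m} (ds : Vec ℕ m) (y : Vec Bool (sum ds)) → wt (shadow ds y) ≤ wt y
wt-shadow []           []          = z≤n
wt-shadow (zero ∷ ds)  y           = wt-shadow ds y
wt-shadow (suc d ∷ ds) (false ∷ y) = wt-shadow (d ∷ ds) y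
wt-shadow (suc d ∷ ds) (true ∷ y)  = s≤s (≤-trans (wt-tail (shadow (d ∷ ds) y)) (wt-shadow (d ∷ ds) y))
  where
  wt-tail : ∀ {n} (v : Vec Bool (suc n)) → wt (tail v) ≤ wt v
  wt-tail (true ∷ v)  = n≤1+n _
  wt-tail (false ∷ v) = ≤-refl

-- For a down-set `S` these are the words `Admissible` for some member of `S`, that is, the
-- neighbours in Hall's condition.
neighbourhood : ∀ {m} → ℕ → (ds : Vec ℕ m) → Family m → Family (sum ds)
neighbourhood s ds S y = ball s y ∧ S (shadow ds y)

pad : ∀ d {n} → Vec Bool n → Vec Bool (d + n)
pad zero    y = y
pad (suc d) y = false ∷ pad d y

wt-pad : ∀ d {n} (y : Vec Bool n) → wt (pad d y) ≡ wt y
wt-pad zero    y = refl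
wt-pad (suc d) y = wt-pad d y

shadow-pad : ∀ {m} d (ds : Vec ℕ m) y → shadow (d ∷ ds) (pad d y) ≡ false ∷ shadow ds y
shadow-pad zero    ds y = refl
shadow-pad (suc d) ds y = shadow-pad d ds y

card-pad : ∀ d {n} (S : Family (d + n)) → card (S ∘ pad d) ≤ card S
card-pad zero    S = ≤-refl
card-pad (suc d) S = ≤-trans (card-pad d (link false S)) (m≤m+n _ _)

card-neighbourhood-zero : ∀ {m} s d (ds : Vec ℕ m) (S : Family (suc m)) →
  card (neighbourhood s ds (link false S)) ≤ card (neighbourhood s (d ∷ ds) S)
card-neighbourhood-zero s zero    ds S = ≤-refl
card-neighbourhood-zero s (suc d) ds S = ≤-trans (card-neighbourhood-zero s d ds S) (m≤m+n _ _)

-- Counts only the words with no entry in the first part, or with exactly one, at any of its `d`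
-- positions.
card-neighbourhood-suc : ∀ {m} s d (ds : Vec ℕ m) (S : Family (suc m)) →
  card (neighbourhood (suc s) ds (link false S)) + d * card (neighbourhood s ds (link true S)) ≤
  card (neighbourhood (suc s) (d ∷ ds) S)
card-neighbourhood-suc s zero    ds S = ≤-reflexive (+-identityʳ _)
card-neighbourhood-suc s (suc d) ds S = begin
  a + (b + d * b)                                      ≡⟨ lemma a b (d * b) ⟩
  (a + d * b) + b                                      ≤⟨ +-mono-≤ (card-neighbourhood-suc s d ds S) step ⟩
  card (neighbourhood (suc s) (d ∷ ds) S) + card P     ∎
  where
  open ≤-Reasoning
  a = card (neighbourhood (suc s) ds (link false S))
  b = card (neighbourhood s ds (link true S))
  P = link true (neighbourhood (suc s) (suc d ∷ ds) S)
  lemma : ∀ a b c → a + (b + c) ≡ (a + c) + b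
  lemma = solve-∀
  step : b ≤ card P
  step = begin
    -- The words with their only entry of the first part in its first position: `pad` fills the rest
    -- of the part with `false`.
    b                  ≡⟨ card-cong (λ y → cong₂ (λ k v → (k <ᵇ suc s) ∧ S (true ∷ tail v)) (wt-pad d y) (shadow-pad d ds y)) ⟨
    card (P ∘ pad d)   ≤⟨ card-pad d P ⟩
    card P             ∎

-- Each s-set of `S` is the shadow of at least `d ^ s` words of weight `s`, one position being
-- chosen in each of its parts.
layer≤neighbourhood : ∀ {m d} s {ds : Vec ℕ m} → VAll.All (d ≤_) ds → (S : Family m) →
  d ^ s * layer s S ≤ card (neighbourhood s ds S)
layer≤neighbourhood         zero    []            S = ≤-reflexive (+-identityʳ _)
layer≤neighbourhood {d = d} (suc s) []            S = ≤-trans (≤-reflexive (*-zeroʳ (d ^ suc s))) z≤n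
layer≤neighbourhood         zero    (_∷_ {x = d′} {xs = ds} _ ds≥d) S =
  ≤-trans (layer≤neighbourhood zero ds≥d (link false S)) (card-neighbourhood-zero zero d′ ds S)
layer≤neighbourhood {d = d} (suc s) (_∷_ {x = d′} {xs = ds} d′≥d ds≥d) S = begin
  d ^ suc s * (a + b)              ≡⟨ lemma d (d ^ s) a b ⟩
  d ^ suc s * a + d * (d ^ s * b)  ≤⟨ +-mono-≤ (layer≤neighbourhood (suc s) ds≥d (link false S))
                                                 (*-mono-≤ d′≥d (layer≤neighbourhood s ds≥d (link true S))) ⟩
  card (neighbourhood (suc s) ds (link false S)) + d′ * card (neighbourhood s ds (link true S))
                                   ≤⟨ card-neighbourhood-suc s d′ ds S ⟩
  card (neighbourhood (suc s) (d′ ∷ ds) S) ∎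
  where
  open ≤-Reasoning
  a = layer (suc s) (link false S)
  b = layer s (link true S)
  lemma : ∀ d e a b → d * e * (a + b) ≡ d * e * a + d * (e * b)
  lemma = solve-∀

-- One position chosen in each nonempty part embeds the sets of size at most `s`.
below≤neighbourhood : ∀ {m} s {ds : Vec ℕ m} → VAll.All (1 ≤_) ds → (S : Family m) →
  below (suc s) S ≤ card (neighbourhood s ds S)
below≤neighbourhood zero    []            S = ≤-refl
below≤neighbourhood (suc s) []            S = ≤-trans (≤-reflexive (+-identityʳ _)) (below≤neighbourhood s [] S)
below≤neighbourhood zero    (_∷_ {x = d} {xs = ds} _ ds≥1) S =
  ≤-trans (below≤neighbourhood zero ds≥1 (link false S)) (card-neighbourhood-zero zero d ds S)
below≤neighbourhood (suc s) (_∷_ {x = d} {xs = ds} d≥1 ds≥1) S = begin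
  below (suc (suc s)) S
    ≡⟨ below-suc (suc s) S ⟩
  below (suc (suc s)) (link false S) + below (suc s) (link true S)
    ≤⟨ +-mono-≤ (below≤neighbourhood (suc s) ds≥1 (link false S))
                (≤-trans (≤-reflexive (sym (*-identityˡ _))) (*-mono-≤ d≥1 (below≤neighbourhood s ds≥1 (link true S)))) ⟩
  card (neighbourhood (suc s) ds (link false S)) + d * card (neighbourhood s ds (link true S))
    ≤⟨ card-neighbourhood-suc s d ds S ⟩
  card (neighbourhood (suc s) (d ∷ ds) S) ∎
  where open ≤-Reasoning

-- Down-closures and Hall's condition

_⊑?_ : ∀ {n} (x y : Vec Bool n) → Dec (x ⊑ y)
_⊑?_ = Pointwise.decidable Bool._≤?_

⊑-trans : ∀ {n} {x y z : Vec Bool n} → x ⊑ y → y ⊑ z → x ⊑ z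
⊑-trans = Pointwise.trans Bool.≤-trans

downClosure : ∀ {n} → List (Vec Bool n) → Family n
downClosure R x = does (any? (x ⊑?_) R)

downClosure-elim : ∀ {n} (R : List (Vec Bool n)) {x} → downClosure R x ≡ true → Any (x ⊑_) R
downClosure-elim R {x} eq with any? (x ⊑?_) R
... | yes p = p

downClosure-down : ∀ {n} (R : List (Vec Bool n)) → DownSet (downClosure R)
downClosure-down R {x} x⊑y y∈ = dec-true (any? (x ⊑?_) R) (Any.map (⊑-trans x⊑y) (downClosure-elim R y∈))

downClosure-⊇ : ∀ {n} (R : List (Vec Bool n)) {x} → x ∈ R → downClosure R x ≡ true
downClosure-⊇ R {x} x∈R = dec-true (any? (x ⊑?_) R) (lose x∈R ⊑-refl)

∧-true : ∀ {a b} → a ∧ b ≡ true → a ≡ true × b ≡ true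
∧-true {true} {true} _ = refl , refl

Admissible : ∀ {m} → ℕ → (ds : Vec ℕ m) → Vec Bool m → Vec Bool (sum ds) → Set
Admissible w ds x y = wt y ≤ w × shadow ds y ⊑ x

-- A word whose shadow is below a member of the down-closure of `R` is already admissible for a
-- member of `R`. Closing `R` thus adds no neighbours, and expansion of down-sets suffices.
hallCondition : ∀ {m} w (ds : Vec ℕ m) →
  (∀ (S : Family m) → DownSet S → card S ≤ card (neighbourhood w ds S)) →
  HallCondition _≟W_ _≟W_ (Admissible w ds)
hallCondition w ds expands R u = N , filter⁺ N? (allWords-unique (sum ds)) , adjacent , (begin
  length R                        ≤⟨ unique-length-≤-card u (downClosure-⊇ R) ⟩
  card S                          ≤⟨ expands S (downClosure-down R) ⟩
  card (neighbourhood w ds S)     ≤⟨ card-mono (λ y → dec-true (N? y)) ⟩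
  card (λ y → does (N? y))        ≡⟨ length-filter-allWords (sum ds) N? ⟨
  length N                        ∎)
  where
  open ≤-Reasoning
  S = downClosure R
  N? : Decidable (λ y → neighbourhood w ds S y ≡ true)
  N? y = neighbourhood w ds S y Bool.≟ true
  N = filter N? (allWords (sum ds))
  adjacent : ∀ {y} → y ∈ N → ∃ λ x → x ∈ R × Admissible w ds x y
  adjacent {y} y∈N =
    let y∈ball , y∈S = ∧-true (proj₂ (∈-filter⁻ N? {xs = allWords (sum ds)} y∈N))
        x , x∈R , y⊑x = find (downClosure-elim R y∈S)
    in x , x∈R , ball-elim w y y∈ball , y⊑x

⊑-lookup : ∀ {n} {x y : Vec Bool n} → x ⊑ y → ∀ i → lookup x i ≡ true → lookup y i ≡ true
⊑-lookup (Bool.b≤b ∷ _) zero    eq = eq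
⊑-lookup (Bool.f≤t ∷ _) zero    eq = refl
⊑-lookup (_ ∷ x⊑y)      (suc i) eq = ⊑-lookup x⊑y i eq

-- Joining each right vertex only to the index of its part makes domination follow from
-- `shadow ds (φ x) ⊑ x`, which a matching along `Admissible` provides.
domination : ∀ {m} w (ds : Vec ℕ m) →
  (∀ (S : Family m) → DownSet S → card S ≤ card (neighbourhood w ds S)) →
  DominationMapping m (sum ds) w
domination {m} w ds expands
  with hall-theorem _≟W_ _≟W_ (Admissible w ds) (hallCondition w ds expands)
         -- The zero word is the default value of the empty matching.
         (replicate (sum ds) false) (allWords m) (allWords-unique m)
... | φ , φ-matching =
  φ
  , (λ x → proj₁ (valid (∈-allWords x)))
  , (λ {x} {y} → injective (∈-allWords x) (∈-allWords y))
  , edge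
  , (λ j → part ds j , dec-true (part ds j Fin.≟ part ds j) refl)
  , dominating
  where
  open IsMatching φ-matching
  edge : Fin m → Fin (sum ds) → Bool
  edge i j = does (part ds j Fin.≟ i)
  dominating : IsDominating m (sum ds) edge φ
  dominating x i j e xi with part ds j Fin.≟ i
  ... | yes refl = Bool.¬-not λ φxj → case trans (sym xi)
    (⊑-lookup (proj₂ (valid (∈-allWords x))) i (shadow-part ds (φ x) j φxj)) of λ ()

-- Expansion of down-sets

extend-weight : ∀ {n} (x : Vec Bool n) w → wt x ≤ w → w ≤ n → ∃ λ y → x ⊑ y × wt y ≡ w
extend-weight []          zero    _         _         = [] , [] , refl
extend-weight (true ∷ x)  (suc w) (s≤s x≤w) (s≤s w≤n) =
  let y , x⊑y , eq = extend-weight x w x≤w w≤n in true ∷ y , Bool.b≤b ∷ x⊑y , cong suc eq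
extend-weight (false ∷ x) zero    x≤w       _         =
  false ∷ x , ⊑-refl , n≤0⇒n≡0 x≤w
extend-weight (false ∷ x) (suc w) x≤w       (s≤s w≤n) with wt x ≤? w
... | yes x≤w′ = let y , x⊑y , eq = extend-weight x w x≤w′ w≤n in true ∷ y , Bool.f≤t ∷ x⊑y , cong suc eq
... | no  x≰w  = false ∷ x , ⊑-refl , ≤-antisym x≤w (≰⇒> x≰w)

-- The shadow of a word in the ball has at most `w` elements, so it extends to a w-set, which lies
-- in `S`. Hence the neighbourhood contains the whole ball.
expansion-full : ∀ {m w} (ds : Vec ℕ m) {S : Family m} → DownSet S → w ≤ m →
  2 ^ m ≤ below (suc w) (full {sum ds}) → (∀ x → wt x ≡ w → S x ≡ true) →
  card S ≤ card (neighbourhood w ds S)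
expansion-full {m} {w} ds {S} down w≤m large all = begin
  card S                          ≤⟨ card-mono {m} {S} {full} (λ _ _ → refl) ⟩
  card (full {m})                 ≡⟨ card-full m ⟩
  2 ^ m                           ≤⟨ large ⟩
  below (suc w) (full {sum ds})   ≡⟨ card-ball (sum ds) w ⟨
  card (ball {sum ds} w)          ≤⟨ card-mono (λ y y∈ → cong₂ _∧_ y∈ (shadow∈S y (ball-elim w y y∈))) ⟩
  card (neighbourhood w ds S)     ∎
  where
  open ≤-Reasoning
  shadow∈S : ∀ y → wt y ≤ w → S (shadow ds y) ≡ true
  shadow∈S y y≤w =
    let z , ⊑z , eq = extend-weight (shadow ds y) w (≤-trans (wt-shadow ds y) y≤w) w≤m
    in down ⊑z (all z eq)

-- The missing `x` improves the factor 2^w over the deletion to `mersenne w`. Layer `w` controls the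
-- deletion, and `gap` lets the `d ^ w` words per w-set of `S` pay for it.
expansion-missing : ∀ {m w d M} {ds : Vec ℕ m} {S : Family m} → DownSet S →
  VAll.All (d ≤_) ds → 1 ≤ d → M + w ≡ m → 1 ≤ binom M w → 1 ≤ binom m w →
  mersenne w * (below w (full {M}) * binom M w + 2 ^ M) ≤ d ^ w * binom M w →
  ∀ x → wt x ≡ w → S x ≡ false →
  card S ≤ card (neighbourhood w ds S)
expansion-missing {m} {w} {d} {M} {ds} {S} down ds≥d d≥1 M+w≡m b>0 b′>0 gap x wx Sx
  with layer w S in eq
-- Without w-sets, the density bound leaves only sets of size less than `w`, which embed directly.
... | zero = *-cancelʳ-≤ _ _ (binom m w) {{>-nonZero b′>0}} (begin
  card S * binom m w                         ≤⟨ card-density w down ⟩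
  below w S * binom m w + layer w S * 2 ^ m  ≡⟨ cong (λ t → below w S * binom m w + t * 2 ^ m) eq ⟩
  below w S * binom m w + 0                  ≡⟨ +-identityʳ _ ⟩
  below w S * binom m w                      ≤⟨ *-monoˡ-≤ _ (below-monoˡ S (n≤1+n w)) ⟩
  below (suc w) S * binom m w                ≤⟨ *-monoˡ-≤ _ (below≤neighbourhood w (VAll.map (≤-trans d≥1) ds≥d) S) ⟩
  card (neighbourhood w ds S) * binom m w    ∎)
  where open ≤-Reasoning
... | suc t with +-cancelʳ-≡ w (avoids x) M (trans (trans (cong (avoids x +_) (sym wx)) (avoids+wt x)) (sym M+w≡m))
... | refl = ≤-trans (*-cancelʳ-≤ _ _ b {{>-nonZero b>0}} (begin
  card S * b                               ≤⟨ *-monoˡ-≤ b (card-deletion-missing x down Sx) ⟩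
  mersenne (wt x) * card D * b             ≡⟨ cong (λ k → mersenne k * card D * b) wx ⟩
  p * card D * b                           ≡⟨ *-assoc p (card D) b ⟩
  p * (card D * b)                         ≤⟨ *-monoʳ-≤ p (card-density w (deletion-down x down)) ⟩
  p * (below w D * b + layer w D * 2 ^ M)  ≤⟨ *-monoʳ-≤ p (+-mono-≤ (*-monoˡ-≤ b (below-mono w (λ _ _ → refl)))
                                               (*-monoˡ-≤ (2 ^ M) (≤-trans (layer-deletion w x S) (≤-reflexive eq)))) ⟩
  -- As layer `w` is nonempty, the low layers may be counted `suc t` times; then `suc t` factors out
  -- and `gap` applies.
  p * (L * b + suc t * 2 ^ M)              ≤⟨ *-monoʳ-≤ p (+-monoˡ-≤ (suc t * 2 ^ M) (m≤n*m (L * b) (suc t))) ⟩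
  p * (suc t * (L * b) + suc t * 2 ^ M)    ≡⟨ lemma p (suc t) (L * b) (2 ^ M) ⟩
  suc t * (p * (L * b + 2 ^ M))            ≤⟨ *-monoʳ-≤ (suc t) gap ⟩
  suc t * (d ^ w * b)                      ≡⟨ lemma′ (suc t) (d ^ w) b ⟩
  d ^ w * suc t * b                        ∎))
  (subst (λ t → d ^ w * t ≤ card (neighbourhood w ds S)) eq (layer≤neighbourhood w ds≥d S))
  where
  open ≤-Reasoning
  b = binom M w
  p = mersenne w
  D = deletion x S
  L = below w (full {M})
  lemma : ∀ p t a e → p * (t * a + t * e) ≡ t * (p * (a + e))
  lemma = solve-∀
  lemma′ : ∀ t a b → t * (a * b) ≡ a * t * b
  lemma′ = solve-∀

expansion : ∀ {m w d M} {ds : Vec ℕ m} →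
  VAll.All (d ≤_) ds → 1 ≤ d → M + w ≡ m → 1 ≤ binom M w → 1 ≤ binom m w →
  2 ^ m ≤ below (suc w) (full {sum ds}) →
  mersenne w * (below w (full {M}) * binom M w + 2 ^ M) ≤ d ^ w * binom M w →
  ∀ (S : Family m) → DownSet S → card S ≤ card (neighbourhood w ds S)
expansion {m} {w} {M = M} {ds} ds≥d d≥1 M+w≡m b>0 b′>0 large gap S down
  with any? (λ x → (wt x ≟ w) ×-dec (S x Bool.≟ false)) (allWords m)
... | yes missing = let x , _ , wx , Sx = find missing in
  expansion-missing down ds≥d d≥1 M+w≡m b>0 b′>0 gap x wx Sx
... | no none = expansion-full ds down (subst (w ≤_) M+w≡m (m≤n+m w M)) large
  λ x wx → Bool.¬-not λ Sx → none (lose (∈-allWords x) (wx , Sx))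

-- Asymptotic estimates

^-distribʳ-* : ∀ a b k → (a * b) ^ k ≡ a ^ k * b ^ k
^-distribʳ-* a b zero    = refl
^-distribʳ-* a b (suc k) = trans (cong (a * b *_) (^-distribʳ-* a b k)) ([m*n]*[o*p]≡[m*o]*[n*p] a b (a ^ k) (b ^ k))

bernoulli : ∀ x k → x ^ suc k + suc k * x ^ k ≤ suc x ^ suc k
bernoulli x zero    = ≤-reflexive (lemma x)
  where
  lemma : ∀ x → x * 1 + 1 ≡ suc x * 1
  lemma = solve-∀
bernoulli x (suc k) = begin
  x * (x * y) + suc (suc k) * (x * y)       ≤⟨ m≤m+n _ (suc k * y) ⟩
  x * (x * y) + suc (suc k) * (x * y) + suc k * y ≡⟨ lemma x y k ⟩
  suc x * (x * y + suc k * y)               ≤⟨ *-monoʳ-≤ (suc x) (bernoulli x k) ⟩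
  suc x * suc x ^ suc k                     ∎
  where
  open ≤-Reasoning
  y = x ^ k
  lemma : ∀ x y k → x * (x * y) + suc (suc k) * (x * y) + suc k * y ≡ suc x * (x * y + suc k * y)
  lemma = solve-∀

-- (1 - 1/(q+1))^k ≥ 1 - k/(q+1), where q + 1 = k + e.
bernoulli-lower : ∀ q k e → suc q ≡ k + e → suc q ^ k * e ≤ q ^ k * suc q
bernoulli-lower q zero    e eq = ≤-reflexive (cong (_+ 0) (sym eq))
bernoulli-lower q (suc k) e eq = begin
  suc q * suc q ^ k * e         ≡⟨ lemma (suc q) (suc q ^ k) e ⟩
  suc q ^ k * (e + q * e)       ≤⟨ *-monoʳ-≤ (suc q ^ k) (+-monoˡ-≤ (q * e) e≤q) ⟩
  suc q ^ k * (q + q * e)       ≡⟨ lemma′ q (suc q ^ k) e ⟩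
  q * (suc q ^ k * suc e)       ≤⟨ *-monoʳ-≤ q (bernoulli-lower q k (suc e) (trans eq (sym (+-suc k e)))) ⟩
  q * (q ^ k * suc q)           ≡⟨ *-assoc q _ _ ⟨
  q * q ^ k * suc q             ∎
  where
  open ≤-Reasoning
  e≤q : e ≤ q
  e≤q = subst (e ≤_) (sym (suc-injective eq)) (m≤n+m e k)
  lemma : ∀ s a e → s * a * e ≡ a * (s * e)
  lemma = solve-∀
  lemma′ : ∀ q a e → a * (q + q * e) ≡ q * (a * suc e)
  lemma′ = solve-∀

-- Induction by Pascal's rule. The shift of `n` by `w` makes the step an instance of `bernoulli`.
below-full-upper : ∀ n w → w ! * below (suc w) (full {n}) ≤ (n + w) ^ w
below-full-upper zero    zero    = ≤-refl
below-full-upper (suc n) zero    = below-full-upper n zero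
below-full-upper zero    (suc w) = begin
  suc w * w ! * (below (suc w) (full {0}) + 0)  ≡⟨ lemma (suc w) (w !) _ ⟩
  suc w * (w ! * below (suc w) (full {0}))      ≤⟨ *-monoʳ-≤ (suc w) (below-full-upper zero w) ⟩
  suc w * w ^ w                                 ≤⟨ *-monoʳ-≤ (suc w) (^-monoˡ-≤ w (n≤1+n w)) ⟩
  suc w * suc w ^ w                             ∎
  where
  open ≤-Reasoning
  lemma : ∀ a b c → a * b * (c + 0) ≡ a * (b * c)
  lemma = solve-∀
below-full-upper (suc n) (suc w) = begin
  suc w ! * below (suc (suc w)) (full {suc n})   ≡⟨ cong (suc w ! *_) (below-suc (suc w) (full {suc n})) ⟩
  suc w * w ! * (A + B)                          ≡⟨ lemma (suc w) (w !) A B ⟩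
  suc w ! * A + suc w * (w ! * B)                ≤⟨ +-mono-≤ (below-full-upper n (suc w)) (*-monoʳ-≤ (suc w) (below-full-upper n w)) ⟩
  x ^ suc w + suc w * (n + w) ^ w                ≤⟨ +-monoʳ-≤ (x ^ suc w) (*-monoʳ-≤ (suc w) (^-monoˡ-≤ w (+-monoʳ-≤ n (n≤1+n w)))) ⟩
  x ^ suc w + suc w * x ^ w                      ≤⟨ bernoulli x w ⟩
  suc x ^ suc w                                  ∎
  where
  open ≤-Reasoning
  x = n + suc w
  A = below (suc (suc w)) (full {n})
  B = below (suc w) (full {n})
  lemma : ∀ s f a b → s * f * (a + b) ≡ s * f * a + s * (f * b)
  lemma = solve-∀

binom-zero : ∀ n → binom n 0 ≡ 1
binom-zero zero    = refl
binom-zero (suc n) = binom-zero n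

-- The right side is the falling factorial of `n`, whose `k` factors are all at least `x`.
binom-lower : ∀ x k n → x + k ≤ n → x ^ k ≤ k ! * binom n k
binom-lower x zero    n _  = ≤-reflexive (sym (trans (+-identityʳ _) (binom-zero n)))
binom-lower x (suc k) n le = begin
  x * x ^ k                       ≤⟨ *-mono-≤ (m+n≤o⇒m≤o∸n x x+k≤n) (binom-lower x k n x+k≤n) ⟩
  (n ∸ k) * (k ! * binom n k)     ≡⟨ lemma (n ∸ k) (k !) (binom n k) ⟩
  k ! * ((n ∸ k) * binom n k)     ≡⟨ cong (k ! *_) (binom-suc n k) ⟨
  k ! * (suc k * binom n (suc k)) ≡⟨ lemma′ (k !) (suc k) (binom n (suc k)) ⟩
  suc k * k ! * binom n (suc k)   ∎
  where
  open ≤-Reasoning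
  x+k≤n : x + k ≤ n
  x+k≤n = ≤-trans (+-monoʳ-≤ x (n≤1+n k)) le
  lemma : ∀ a b c → a * (b * c) ≡ b * (a * c)
  lemma = solve-∀
  lemma′ : ∀ a b c → a * (b * c) ≡ b * a * c
  lemma′ = solve-∀

binom-positive : ∀ {n k} → suc k ≤ n → 1 ≤ binom n k
binom-positive {n} {k} k<n with binom n k | binom-lower 1 k n k<n
... | suc _ | _  = s≤s z≤n
... | zero  | le = contradiction (≤-trans (≤-reflexive (sym (^-zeroˡ k))) (≤-trans le (≤-reflexive (*-zeroʳ (k !))))) λ ()

n≤2^n : ∀ n → n ≤ 2 ^ n
n≤2^n zero    = z≤n
n≤2^n (suc n) = +-mono-≤ (m^n>0 2 n) (≤-trans (n≤2^n n) (≤-reflexive (sym (+-identityʳ _))))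

-- Halving `n` to h splits off two factors 2^h: one absorbs the additional factor h, the other the
-- lower power by induction.
exponential-dominates : ∀ k c → ∃ λ n₀ → ∀ n → n₀ ≤ n → c * n ^ k ≤ 2 ^ n
exponential-dominates zero    c = c , λ n c≤n →
  ≤-trans (≤-reflexive (*-identityʳ c)) (≤-trans (n≤2^n c) (^-monoʳ-≤ 2 c≤n))
exponential-dominates (suc k) c with exponential-dominates k (c * 3 ^ suc k)
-- This threshold makes h exceed `h₀`, hence positive, so the remainder of `n` is at most h and
-- `n ≤ 3 * h`; this is where the power of 3 in the constant comes from.
... | h₀ , ih = suc h₀ * 2 , λ n n₀≤n →
  let open ≤-Reasoning
      h = n / 2
      h₀<h : h₀ < h
      h₀<h = ≤-trans (≤-reflexive (sym (m*n/n≡m (suc h₀) 2))) (/-monoˡ-≤ 2 n₀≤n)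
      h≥1 : 1 ≤ h
      h≥1 = ≤-trans (s≤s z≤n) h₀<h
      n≡ : n ≡ n % 2 + h * 2
      n≡ = m≡m%n+[m/n]*n n 2
      n≤3h : n ≤ 3 * h
      n≤3h = begin
        n              ≡⟨ n≡ ⟩
        n % 2 + h * 2  ≤⟨ +-monoˡ-≤ (h * 2) (≤-trans (s≤s⁻¹ (m%n<n n 2)) h≥1) ⟩
        h + h * 2      ≡⟨ lemma h ⟩
        3 * h          ∎
  in begin
  c * n ^ suc k                  ≤⟨ *-monoʳ-≤ c (^-monoˡ-≤ (suc k) n≤3h) ⟩
  c * (3 * h) ^ suc k            ≡⟨ cong (c *_) (^-distribʳ-* 3 h (suc k)) ⟩
  c * (3 ^ suc k * (h * h ^ k))  ≡⟨ lemma′ c (3 ^ suc k) h (h ^ k) ⟩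
  c * 3 ^ suc k * h ^ k * h      ≤⟨ *-mono-≤ (ih h (<⇒≤ h₀<h)) (n≤2^n h) ⟩
  2 ^ h * 2 ^ h                  ≡⟨ ^-distribˡ-+-* 2 h h ⟨
  2 ^ (h + h)                    ≡⟨ cong (2 ^_) (lemma″ h) ⟩
  2 ^ (h * 2)                    ≤⟨ ^-monoʳ-≤ 2 (≤-trans (m≤n+m _ (n % 2)) (≤-reflexive (sym n≡))) ⟩
  2 ^ n                          ∎
  where
  lemma : ∀ h → h + h * 2 ≡ 3 * h
  lemma = solve-∀
  lemma′ : ∀ c t h a → c * (t * (h * a)) ≡ c * t * a * h
  lemma′ = solve-∀
  lemma″ : ∀ h → h + h ≡ h * 2
  lemma″ = solve-∀

-- From m = x + 2w and n < (d + 1) m, the ratio (n + w) / (d x) tends to 1.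
ratio-bound : ∀ {q w d x m n} → m ≡ x + (w + w) → n ≤ d * m + m →
  4 * (w * q) ≤ x → 3 * w ≤ x → 4 * q ≤ d → q * (n + w) ≤ suc q * (d * x)
ratio-bound {q} {w} {d} {x} {_} {n} refl n≤ wq≤x w≤x q≤d = *-cancelˡ-≤ 2 (begin
  2 * (q * (n + w))
    ≤⟨ *-monoʳ-≤ 2 (*-monoʳ-≤ q (+-monoˡ-≤ w n≤)) ⟩
  2 * (q * (d * (x + (w + w)) + (x + (w + w)) + w))
    ≡⟨ lemma q d x w ⟩
  2 * (q * (d * x)) + 4 * (w * q) * d + 2 * q * (x + 3 * w)
    ≤⟨ +-mono-≤ (+-monoʳ-≤ (2 * (q * (d * x))) (*-monoˡ-≤ d wq≤x)) (*-monoʳ-≤ (2 * q) (+-monoʳ-≤ x w≤x)) ⟩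
  2 * (q * (d * x)) + x * d + 2 * q * (x + x)
    ≡⟨ lemma′ q d x ⟩
  2 * (q * (d * x)) + x * d + 4 * q * x
    ≤⟨ +-monoʳ-≤ (2 * (q * (d * x)) + x * d) (*-monoˡ-≤ x q≤d) ⟩
  2 * (q * (d * x)) + x * d + d * x
    ≡⟨ lemma″ q d x ⟩
  2 * (suc q * (d * x)) ∎)
  where
  open ≤-Reasoning
  lemma : ∀ q d x w → 2 * (q * (d * (x + (w + w)) + (x + (w + w)) + w)) ≡
    2 * (q * (d * x)) + 4 * (w * q) * d + 2 * q * (x + 3 * w)
  lemma = solve-∀
  lemma′ : ∀ q d x → 2 * (q * (d * x)) + x * d + 2 * q * (x + x) ≡ 2 * (q * (d * x)) + x * d + 4 * q * x
  lemma′ = solve-∀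
  lemma″ : ∀ q d x → 2 * (q * (d * x)) + x * d + d * x ≡ 2 * (suc q * (d * x))
  lemma″ = solve-∀

-- In quotients: (b/a)^w ≤ ((q+1)/q)^w ≤ v/u.
power-ratio-bound : ∀ {q w a b u v} → u * suc q ^ w ≤ v * q ^ w → q * b ≤ suc q * a →
  u * b ^ w ≤ v * a ^ w
power-ratio-bound {q} {w} {a} {b} {u} {v} uv qb = *-cancelʳ-≤ _ _ (suc q ^ w) {{m^n≢0 (suc q) w}} (begin
  u * b ^ w * suc q ^ w      ≡⟨ lemma u (b ^ w) (suc q ^ w) ⟩
  u * suc q ^ w * b ^ w      ≤⟨ *-monoˡ-≤ (b ^ w) uv ⟩
  v * q ^ w * b ^ w          ≡⟨ *-assoc v _ _ ⟩
  v * (q ^ w * b ^ w)        ≡⟨ cong (v *_) (^-distribʳ-* q b w) ⟨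
  v * (q * b) ^ w            ≤⟨ *-monoʳ-≤ v (^-monoˡ-≤ w qb) ⟩
  v * (suc q * a) ^ w        ≡⟨ cong (v *_) (^-distribʳ-* (suc q) a w) ⟩
  v * (suc q ^ w * a ^ w)    ≡⟨ lemma′ v (suc q ^ w) (a ^ w) ⟩
  v * a ^ w * suc q ^ w      ∎)
  where
  open ≤-Reasoning
  lemma : ∀ a b c → a * b * c ≡ a * c * b
  lemma = solve-∀
  lemma′ : ∀ a b c → a * (b * c) ≡ a * c * b
  lemma′ = solve-∀

slow-ratio : ∀ w u → 1 ≤ w → 1 ≤ u → ∃ λ q → u * suc q ^ w ≤ suc u * q ^ w
slow-ratio (suc w) u@(suc _) _ _ = q , *-cancelʳ-≤ _ _ e (begin
  u * suc q ^ suc w * e              ≡⟨ *-assoc u (suc q ^ suc w) e ⟩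
  u * (suc q ^ suc w * e)            ≤⟨ *-monoʳ-≤ u (bernoulli-lower q (suc w) e refl) ⟩
  u * (q ^ suc w * (suc w + e))      ≡⟨ lemma u (q ^ suc w) w ⟩
  suc u * q ^ suc w * e              ∎)
  where
  open ≤-Reasoning
  -- With this choice (suc w + e)/e equals (u + 1)/u, the loss allowed in `bernoulli-lower`.
  e = u * suc w
  q = w + e
  lemma : ∀ u a w → u * (a * (suc w + u * suc w)) ≡ suc u * a * (u * suc w)
  lemma = solve-∀

-- With W = p + 1, this rests on 1 + p (W + 1) = W².
absorb : ∀ {p l b d e} → let W = suc p in
  W * W * (p * l) ≤ d → W * (W * e) ≤ suc W * (d * b) → p * (l * b + e) ≤ d * b
absorb {p} {l} {b} {d} {e} small main = *-cancelˡ-≤ (W * W) (begin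
  W * W * (p * (l * b + e))                 ≡⟨ lemma p l b e ⟩
  W * W * (p * l) * b + p * (W * (W * e))   ≤⟨ +-mono-≤ (*-monoˡ-≤ b small) (*-monoʳ-≤ p main) ⟩
  d * b + p * (suc W * (d * b))             ≡⟨ lemma′ p (d * b) ⟩
  W * W * (d * b)                           ∎)
  where
  open ≤-Reasoning
  W = suc p
  lemma : ∀ p l b e → suc p * suc p * (p * (l * b + e)) ≡ suc p * suc p * (p * l) * b + p * (suc p * (suc p * e))
  lemma = solve-∀
  lemma′ : ∀ p x → x + p * (suc (suc p) * x) ≡ suc p * suc p * x
  lemma′ = solve-∀

-- Supplies the inputs of `absorb`: `small` makes the low layers negligible against `d ^ w`, and
-- `main` bounds 2^(x+w) by (1 + 1/W) d^w b / W.
gap-bound : ∀ {w q d x n} → 1 ≤ w → let p = mersenne w in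
  suc p * suc q ^ w ≤ suc (suc p) * q ^ w → q * (n + w) ≤ suc q * (d * x) →
  suc (suc p * suc p * p) * (x + w + w) ≤ d →
  2 ^ (w + (x + w)) ≤ below (suc w) (full {n}) →
  p * (below w (full {x + w}) * binom (x + w) w + 2 ^ (x + w)) ≤ d ^ w * binom (x + w) w
gap-bound {w} {q} {d} {x} {n} 1≤w slow ratio d-large ball-large =
  absorb {p} {L} {b} {d ^ w} {2 ^ (x + w)} small main
  where
  open ≤-Reasoning
  p = mersenne w
  W = suc p
  b = binom (x + w) w
  L = below w (full {x + w})
  c = suc (W * W * p)
  instance
    w!≢0 : NonZero (w !)
    w!≢0 = w !≢0
    w≢0 : NonZero w
    w≢0 = >-nonZero 1≤w
  -- `L` is at most (x + 2w)^w, which `d-large` beats by `c ^ w`, and this is at least `c`.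
  small : W * W * (p * L) ≤ d ^ w
  small = begin
    W * W * (p * L)              ≡⟨ *-assoc (W * W) p L ⟨
    W * W * p * L                ≤⟨ *-monoˡ-≤ L (n≤1+n (W * W * p)) ⟩
    c * L                        ≤⟨ *-mono-≤ (m≤m^n c) (≤-trans (below-monoˡ full (n≤1+n w)) (m≤n*m _ (w !))) ⟩
    c ^ w * (w ! * below (suc w) (full {x + w})) ≤⟨ *-monoʳ-≤ (c ^ w) (below-full-upper (x + w) w) ⟩
    c ^ w * (x + w + w) ^ w      ≡⟨ ^-distribʳ-* c (x + w + w) w ⟨
    (c * (x + w + w)) ^ w        ≤⟨ ^-monoˡ-≤ w d-large ⟩
    d ^ w                        ∎
    where
    m≤m^n : ∀ m .{{_ : NonZero m}} → m ≤ m ^ w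
    m≤m^n m = ≤-trans (≤-reflexive (sym (^-identityʳ m))) (^-monoʳ-≤ m 1≤w)
  -- One factor `W`, being 2^w, raises 2^(x+w) to the 2^(x+2w) of the hypothesis on the ball; the
  -- other is used up by `slow`.
  main : W * (W * 2 ^ (x + w)) ≤ suc W * (d ^ w * b)
  main = *-cancelʳ-≤ _ _ (w !) (begin
    W * (W * 2 ^ (x + w)) * w !            ≡⟨ cong (λ v → W * (v * 2 ^ (x + w)) * w !) (suc-mersenne w) ⟩
    W * (2 ^ w * 2 ^ (x + w)) * w !        ≡⟨ cong (λ v → W * v * w !) (^-distribˡ-+-* 2 w (x + w)) ⟨
    W * 2 ^ (w + (x + w)) * w !            ≤⟨ *-monoˡ-≤ (w !) (*-monoʳ-≤ W ball-large) ⟩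
    W * below (suc w) (full {n}) * w !     ≡⟨ lemma W (below (suc w) (full {n})) (w !) ⟩
    W * (w ! * below (suc w) (full {n}))   ≤⟨ *-monoʳ-≤ W (below-full-upper n w) ⟩
    W * (n + w) ^ w                        ≤⟨ power-ratio-bound {q} {w} {d * x} {n + w} {W} {suc W} slow ratio ⟩
    suc W * (d * x) ^ w                    ≡⟨ cong (suc W *_) (^-distribʳ-* d x w) ⟩
    suc W * (d ^ w * x ^ w)                ≤⟨ *-monoʳ-≤ (suc W) (*-monoʳ-≤ (d ^ w) (binom-lower x w (x + w) ≤-refl)) ⟩
    suc W * (d ^ w * (w ! * b))            ≡⟨ lemma′ (suc W) (d ^ w) (w !) b ⟩
    suc W * (d ^ w * b) * w !              ∎)
    where
    lemma : ∀ a b c → a * b * c ≡ a * (c * b)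
    lemma = solve-∀
    lemma′ : ∀ a b c d → a * (b * (c * d)) ≡ a * (b * d) * c
    lemma′ = solve-∀

-- Choice of the parts and of the threshold

-- If `n` were below K m^2, the ball would have size polynomial in `m`, less than 2^m.
part-size-large : ∀ {w} K m n .{{_ : NonZero m}} →
  suc ((K + w) ^ w) * m ^ (w + w) ≤ 2 ^ m → 2 ^ m ≤ below (suc w) (full {n}) → K * m ≤ n / m
part-size-large {w} K m n exp-large ball-large with K * m * m ≤? n
... | yes le = ≤-trans (≤-reflexive (sym (m*n/n≡m (K * m) m))) (/-monoˡ-≤ m le)
... | no ≰n = contradiction (begin-strict
  2 ^ m                                 ≤⟨ ball-large ⟩
  below (suc w) (full {n})              ≤⟨ m≤n*m _ (w !) {{w !≢0}} ⟩
  w ! * below (suc w) (full {n})        ≤⟨ below-full-upper n w ⟩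
  (n + w) ^ w                           ≤⟨ ^-monoˡ-≤ w n+w≤ ⟩
  ((K + w) * (m * m)) ^ w               ≡⟨ ^-distribʳ-* (K + w) (m * m) w ⟩
  (K + w) ^ w * (m * m) ^ w             ≡⟨ cong ((K + w) ^ w *_) (^-distribʳ-* m m w) ⟩
  (K + w) ^ w * (m ^ w * m ^ w)         ≡⟨ cong ((K + w) ^ w *_) (^-distribˡ-+-* m w w) ⟨
  (K + w) ^ w * m ^ (w + w)             <⟨ m<n+m _ (m^n>0 m (w + w)) ⟩
  suc ((K + w) ^ w) * m ^ (w + w)       ≤⟨ exp-large ⟩
  2 ^ m                                 ∎) (<-irrefl refl)
  where
  open ≤-Reasoning
  n+w≤ : n + w ≤ (K + w) * (m * m)
  n+w≤ = begin
    n + w                     ≤⟨ +-mono-≤ (<⇒≤ (≰⇒> ≰n)) (m≤m*n w (m * m) {{m*n≢0 m m}}) ⟩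
    K * m * m + w * (m * m)   ≡⟨ cong (_+ w * (m * m)) (*-assoc K m m) ⟩
    K * (m * m) + w * (m * m) ≡⟨ *-distribʳ-+ (m * m) K w ⟨
    (K + w) * (m * m)         ∎

partition : ∀ m n .{{_ : NonZero m}} → Σ (Vec ℕ m) λ ds → VAll.All (n / m ≤_) ds × sum ds ≡ n
-- The first part takes the whole remainder.
partition m@(suc k) n = (n % m + n / m) ∷ replicate k (n / m)
  , m≤n+m _ _ ∷ all-replicate k
  , trans (cong (n % m + n / m +_) (sum-replicate k))
      (trans (+-assoc (n % m) (n / m) _)
        (trans (cong (n % m +_) (*-comm m (n / m))) (sym (m≡m%n+[m/n]*n n m))))
  where
  all-replicate : ∀ k → VAll.All (n / m ≤_) (replicate k (n / m))
  all-replicate zero    = []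
  all-replicate (suc k) = ≤-refl ∷ all-replicate k
  sum-replicate : ∀ k → sum (replicate k (n / m)) ≡ k * (n / m)
  sum-replicate zero    = refl
  sum-replicate (suc k) = cong (n / m +_) (sum-replicate k)

n≤[n/m]*m+m : ∀ n m .{{_ : NonZero m}} → n ≤ n / m * m + m
n≤[n/m]*m+m n m = begin
  n                    ≡⟨ m≡m%n+[m/n]*n n m ⟩
  n % m + n / m * m    ≤⟨ +-monoˡ-≤ (n / m * m) (<⇒≤ (m%n<n n m)) ⟩
  m + n / m * m        ≡⟨ +-comm m _ ⟩
  n / m * m + m        ∎
  where open ≤-Reasoning

theorem1 : (w : ℕ) → 1 ≤ w →
    Σ ℕ λ m₀ → (m n : ℕ) → m₀ ≤ m → 0 < n →
    2 ^ m ≤ ballSize n w → DominationMapping m n w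
-- The dimension is split as x + w + w: deleting a w-set leaves x + w coordinates, and `binom-lower`
-- spends the other w.
theorem1 w 1≤w = x₀ + (w + w) , λ m n m₀≤m _ large →
  let x+2w≡m = trans (+-assoc (m ∸ (w + w)) w w) (m∸n+n≡m (m+n≤o⇒n≤o x₀ m₀≤m))
  in subst (λ m → 2 ^ m ≤ ballSize n w → DominationMapping m n w) x+2w≡m
       (construct (m ∸ (w + w)) n (m+n≤o⇒m≤o∸n x₀ m₀≤m)) large
  where
  -- `u` is 2^w, the W of `absorb`.
  u = suc (mersenne w)
  slow = slow-ratio w u 1≤w (s≤s z≤n)
  q = proj₁ slow
  c = suc (u * u * mersenne w)
  -- Parts of size at least K m serve both `gap-bound`, through `c`, and `ratio-bound`, through
  -- `4 * q`.
  K = c + 4 * q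
  dominated = exponential-dominates (w + w) (suc ((K + w) ^ w))
  -- The summands serve `ratio-bound` and `part-size-large`; the successor makes x positive, as
  -- `binom-positive` requires.
  x₀ = suc (4 * (w * q) + 3 * w + proj₁ dominated)
  construct : ∀ x n → x₀ ≤ x → 2 ^ (x + w + w) ≤ ballSize n w → DominationMapping (x + w + w) n w
  construct x@(suc _) n x₀≤x large with partition (x + w + w) n
  ... | ds , ds≥d , refl = domination w ds (expansion ds≥d
    (≤-trans (s≤s z≤n) cm≤d) refl
    (binom-positive (+-monoˡ-≤ w (s≤s z≤n)))
    (binom-positive (+-monoˡ-≤ w (≤-trans (s≤s z≤n) (m≤m+n x w))))
    large′
    (gap-bound {q = q} {n = n} 1≤w (proj₂ slow)
      (ratio-bound {q} {w} (+-assoc x w w) (n≤[n/m]*m+m n m)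
        (≤-trans (m≤m+n (4 * (w * q)) _) pieces≤x) (≤-trans (m≤n+m (3 * w) (4 * (w * q))) pieces≤x) 4q≤d)
      cm≤d
      (subst (λ k → 2 ^ k ≤ below (suc w) (full {n})) (+-comm (x + w) w) large′)))
    where
    m = x + w + w
    large′ : 2 ^ m ≤ below (suc w) (full {n})
    large′ = ≤-trans large (ballSize-below n w)
    pieces≤x : 4 * (w * q) + 3 * w ≤ x
    pieces≤x = ≤-trans (m≤m+n _ _) (<⇒≤ x₀≤x)
    e≤m : proj₁ dominated ≤ m
    e≤m = ≤-trans (≤-trans (m≤n+m _ _) (<⇒≤ x₀≤x)) (≤-trans (m≤m+n x w) (m≤m+n (x + w) w))
    Km≤d : K * m ≤ n / m
    Km≤d = part-size-large {w} K m n (proj₂ dominated m e≤m) large′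
    cm≤d : c * m ≤ n / m
    cm≤d = ≤-trans (*-monoˡ-≤ m (m≤m+n c (4 * q))) Km≤d
    4q≤d : 4 * q ≤ n / m
    4q≤d = ≤-trans (m≤n+m (4 * q) c) (≤-trans (m≤m*n K m) Km≤d)
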